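{- Let $r \ge 2$ and $n \ge 1$ be integers. There is a bijection $\Phi$ from $\mathrm{Reg}_r(rn)$ to $\mathrm{Cyc}^*_r(rn)$ with the following property: whenever $\sigma \in \mathrm{Reg}_r(rn)$ and the cycle containing $1$ in $\sigma$ has length $rk+i$ with integers $k\ge 0$ and $1 \le i \le r-1$, the cycle containing $1$ in the underlying permutation of $\Phi(\sigma)$ has length $rk+r$.
   Context: Permutations of $[N]=\{1,\dots,N\}$ are viewed through their disjoint cycle decompositions, fixed points counting as cycles of length $1$. For $r\ge 2$, a cycle is $r$-regular if its length is not divisible by $r$, and $r$-singular if its length is divisible by $r$. $\mathrm{Reg}_r(N)$ is the set of $r$-regular permutations of $[N]$, i.e. those all of whose cycles are $r$-regular. An $r$-cycle permutation is a permutation all of whose cycles are $r$-singular. An enriched ($r$-enriched) permutation is a permutation together with an assignment, to each of its $r$-singular cycles, of one of the $r-1$ colors in $\{1,2,\dots,r-1\}$ ($r$-regular cycles are not colored; different cycles may receive the same color). $\mathrm{Cyc}^*_r(N)$ is the set of enriched $r$-cycle permutations of $[N]$, i.e. permutations of $[N]$ all of whose cycles have length divisible by $r$, with each cycle assigned a color from $\{1,\dots,r-1\}$. -}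

module Defs where

open import Level using (0ℓ)
open import Data.Nat.Base using (ℕ; _*_; _∸_; _≤_)
open import Data.Nat.Divisibility using (_∣_; _∤_)
open import Data.Nat.Properties using (*-mono-≤; <⇒≤)
open import Data.Fin.Base using (Fin; fromℕ<)
open import Data.Fin.Properties using (_≟_)
open import Data.Fin.Permutation using (Permutation′; _⟨$⟩ʳ_; _≈_)
open import Data.List.Base using (List; length; iterate; deduplicate)
open import Data.Product.Base using (_×_; _,_)
open import Relation.Binary.Bundles using (Setoid)
open import Relation.Binary.PropositionalEquality.Core using (_≡_; refl; sym; trans)

-- The cycle of σ through x, as the distinct elements among
-- x, σ x, σ² x, …, σᴺ⁻¹ x; since the cycle has at most N elements, these
-- iterates already exhaust it.
cycle : ∀ {N} → Permutation′ N → Fin N → List (Fin N)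
cycle {N} σ x = deduplicate _≟_ (iterate (σ ⟨$⟩ʳ_) x N)

cycleLength : ∀ {N} → Permutation′ N → Fin N → ℕ
cycleLength σ x = length (cycle σ x)

-- Every cycle is the cycle through some x, so a condition on all cycles is
-- expressed as a condition on the cycles through all points.
record RegularPermutation (r N : ℕ) : Set where
  field
    perm    : Permutation′ N
    regular : ∀ x → r ∤ cycleLength perm x

-- All cycles are r-singular here, so every cycle is coloured.  A colouring of
-- the cycles is a function on points that is constant along each cycle; the
-- colours 1, …, r-1 are represented by Fin (r ∸ 1).
record EnrichedCyclePermutation (r N : ℕ) : Set where
  field
    perm        : Permutation′ N
    singular    : ∀ x → r ∣ cycleLength perm x
    colour      : Fin N → Fin (r ∸ 1)
    colour-cong : ∀ x → colour (perm ⟨$⟩ʳ x) ≡ colour x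

-- Two elements are equal when the underlying permutations agree as functions
-- (and, for enriched ones, the colours agree too); the proof fields and the
-- proofs inside Permutation′ are ignored.
Reg : (r N : ℕ) → Setoid 0ℓ 0ℓ
Reg r N = record
  { Carrier       = RegularPermutation r N
  ; _≈_           = λ σ τ → perm σ ≈ perm τ
  ; isEquivalence = record
    { refl  = λ _ → refl
    ; sym   = λ p x → sym (p x)
    ; trans = λ p q x → trans (p x) (q x)
    }
  }
  where open RegularPermutation

Cyc* : (r N : ℕ) → Setoid 0ℓ 0ℓ
Cyc* r N = record
  { Carrier       = EnrichedCyclePermutation r N
  ; _≈_           = λ σ τ → perm σ ≈ perm τ × (∀ x → colour σ x ≡ colour τ x)
  ; isEquivalence = record
    { refl  = (λ _ → refl) , (λ _ → refl)
    ; sym   = λ (p , c) → (λ x → sym (p x)) , (λ x → sym (c x))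
    ; trans = λ (p , c) (q , d) →
        (λ x → trans (p x) (q x)) , (λ x → trans (c x) (d x))
    }
  }
  where open EnrichedCyclePermutation

-- [N] = {1, …, N} is represented by Fin N, so the point 1 is the element of
-- Fin (r * n) with value 0.
one : ∀ {r n} → 2 ≤ r → 1 ≤ n → Fin (r * n)
one 2≤r 1≤n = fromℕ< (*-mono-≤ (<⇒≤ 2≤r) 1≤n)

{-# OPTIONS --safe #-}
module Submission where

-- Read a permutation of N points cycle by cycle, starting from a current point
-- c: either c is fixed and its cycle is closed (with a label), or c is deleted
-- from its cycle and its predecessor becomes the current point.  When m points
-- are left there are m choices (close, or one of m - 1 predecessors), so
-- permutations correspond to codes, the cycle of the starting point being as
-- long as the number of steps up to the first closing.  Writing R s N for the
-- number of ways to complete an r-regular code when s points of the current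
-- cycle are already deleted and N points are left, one finds for r ∣ N and s < r
--   R s (j + N) = (j + N) ⋯ (1 + N) R 0 N                  if s + j < r,
--   R s (j + N) = (j + N - 1) (j + N - 1) ⋯ (1 + N) R 0 N  if r ≤ s + j and j ≤ r,
-- and from this that, for each k, as many regular codes have first cycle length
-- in rk+1, …, rk+r-1 as coloured r-singular codes have first cycle length rk+r.

open import Data.Bool.Properties using (T-irrelevant)
open import Data.Fin.Base using (Fin; zero; suc; punchIn; punchOut)
open import Data.Fin.Permutation using (Permutation′; _⟨$⟩ʳ_; _⟨$⟩ˡ_; _≈_; _∘ₚ_; id; transpose;
  insert; remove; insert-punchIn; insert-remove; inverseʳ; punchIn-permute)
open import Data.Fin.Properties using (punchInᵢ≢i; punchIn-injective; punchIn-punchOut;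
  +↔⊎; *↔×; 1↔⊤) renaming (_≟_ to _≟ᶠ_)
open import Data.List.Base using (List; []; _∷_; length; iterate; filter; allFin; deduplicate)
import Data.List.Membership.DecPropositional as DecMembership
open import Data.List.Membership.Propositional using (_∈_)
open import Data.List.Membership.Propositional.Properties using (∈-deduplicate⁺;
  ∈-deduplicate⁻; ∈-filter⁺; ∈-filter⁻; ∈-allFin)
open import Data.List.Membership.Propositional.Properties.WithK using (unique∧set⇒bag)
open import Data.List.Properties using (length-iterate; length-filter; length-tabulate)
open import Data.List.Relation.Binary.BagAndSetEquality using (∼bag⇒↭)
open import Data.List.Relation.Binary.Permutation.Propositional.Properties using (↭-length)
open import Data.List.Relation.Unary.All as All using ()
open import Data.List.Relation.Unary.AllPairs using ([]; _∷_)
open import Data.List.Relation.Unary.Any using (here; there)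
open import Data.List.Relation.Unary.Unique.DecPropositional.Properties using (deduplicate-!)
open import Data.List.Relation.Unary.Unique.Propositional using (Unique)
open import Data.List.Relation.Unary.Unique.Propositional.Properties using (allFin⁺; filter⁺)
open import Data.Nat.Base using (ℕ; zero; suc; _+_; _*_; _∸_; _≤_; s≤s; z≤n; _<_; z<s; s<s;
  s<s⁻¹; s≤s⁻¹)
open import Data.Nat.DivMod using (_/_; m<n⇒m/n≡0; m*n/n≡m; +-distrib-/-∣ˡ; +-distrib-/-∣ʳ;
  n/n≡1)
open import Data.Nat.Divisibility using (_∣_; _∤_; _∣?_; ∣-refl; ∣m∣n⇒∣m+n; ∣m+n∣m⇒∣n; >⇒∤;
  divides; n∣m*n; m∣m*n)
open import Data.Nat.Properties using (+-comm; +-assoc; ≤-trans; ≤-refl; ≤-reflexive; <-irrefl; m≤n+m;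
  n≤1+n; +-identityʳ; _≟_; +-suc;
  *-zeroʳ; *-identityˡ; *-identityʳ; ≤-antisym; ≤∧≢⇒<; <⇒≤;
  m≤m+n; ≡-irrelevant; *-comm; suc-injective; 1+n≢0)
open import Data.Nat.Tactic.RingSolver using (solve-∀)
open import Data.Product.Base using (Σ-syntax; ∃; _×_; _,_; proj₁; proj₂)
open import Data.Product.Function.Dependent.Propositional using (congˡ)
open import Data.Product.Function.NonDependent.Propositional using (_×-↔_)
open import Data.Sum.Base using (_⊎_; inj₁; inj₂; [_,_]′)
open import Data.Sum.Function.Propositional using (_⊎-↔_)
open import Data.Unit.Base using (⊤; tt)
open import Data.Vec.Functional using (insertAt)
open import Data.Vec.Functional.Properties using (insertAt-lookup; insertAt-punchIn)
open import Function.Base using (_∘_; const)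
open import Function.Bundles using (Inverse; mk⇔; Injection; Bijection; _↔_; mk↔ₛ′)
import Function.Construct.Composition as Composition
open import Function.Construct.Composition using (_↔-∘_)
open import Function.Construct.Identity using (↔-id)
import Function.Construct.Symmetry as Symmetry
open import Function.Construct.Symmetry using (↔-sym)
open import Function.Definitions using (Injective)
open import Function.Properties.Bijection using (Bijection⇒Inverse)
open import Function.Properties.Inverse using (↔⇒↣; Inverse⇒Bijection)
open import Level using (0ℓ)
open import Relation.Binary.Bundles using (Setoid)
open import Relation.Binary.PropositionalEquality using (_≡_; _≢_; _≗_; refl; sym; trans; cong;
  cong₂; subst; module ≡-Reasoning; setoid)
open import Relation.Nullary using (Dec; yes; no; ¬_; contradiction; ¬?)
open import Relation.Nullary.Decidable using (True; toWitness; fromWitness; dec-true;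
  dec-false; True-↔)
open import Defs

open ≡-Reasoning

-- First return times

-- The weighted number n of steps after which the orbit of x first reaches t.
data Return {A : Set} (f : A → A) (w : A → ℕ) (t : A) : A → ℕ → Set where
  stop : ∀ {x} → f x ≡ t → Return f w t x (w x)
  step : ∀ {x n} → f x ≢ t → Return f w t (f x) n → Return f w t x (w x + n)

module _ {A : Set} {f : A → A} {w : A → ℕ} where

  Return-unique : ∀ {t x m n} → Return f w t x m → Return f w t x n → m ≡ n
  Return-unique (stop _) (stop _) = refl
  Return-unique (stop e) (step ne _) = contradiction e ne
  Return-unique (step ne _) (stop e) = contradiction e ne
  Return-unique (step _ p) (step _ q) = cong (w _ +_) (Return-unique p q)

  Return-cong : ∀ {g v t x n} → f ≗ g → w ≗ v → Return f w t x n → Return g v t x n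
  Return-cong {g} {v} {t} {x} f≗g w≗v (stop e) =
    subst (Return g v t x) (sym (w≗v x)) (stop (trans (sym (f≗g x)) e))
  Return-cong {g} {v} {t} {x} f≗g w≗v (step {n = n} ne p) =
    subst (Return g v t x) (cong (_+ n) (sym (w≗v x)))
      (step (ne ∘ trans (f≗g x)) (subst (λ y → Return g v t y n) (f≗g x) (Return-cong f≗g w≗v p)))

  -- By injectivity `p` is the only preimage of `c`, so an orbit starting elsewhere cannot enter `c`
  -- before passing through `p`.
  Return-extend : Injective _≡_ _≡_ f → ∀ {p c z n} → f p ≡ c → c ≢ p → z ≢ p →
                  Return f w p z n → Return f w c z (n + w p)
  Return-extend inj fp≡c c≢p z≢p (stop refl) = step (c≢p ∘ sym) (stop fp≡c)
  Return-extend inj {p} {c} {z} fp≡c c≢p z≢p (step {n = n} ne q) =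
    subst (Return f w c z) (sym (+-assoc (w z) n (w p)))
      (step (λ fz≡c → z≢p (inj (trans fz≡c (sym fp≡c)))) (Return-extend inj fp≡c c≢p ne q))

  -- The same cycle is traversed, with the summand `w p` moved from the front to the end. Deleting
  -- `c` only yields return times of other points; this recovers that of `c` from its predecessor.
  Return-rotate : Injective _≡_ _≡_ f → ∀ {p c n} → f p ≡ c → c ≢ p →
                  Return f w p p n → Return f w c c n
  Return-rotate inj fp≡c c≢p (stop e) = contradiction (trans (sym fp≡c) e) c≢p
  Return-rotate inj {p} {c} fp≡c c≢p (step {n = n} _ q) =
    subst (Return f w c c) (+-comm n (w p))
      (Return-extend inj fp≡c c≢p c≢p (subst (λ y → Return f w p y n) fp≡c q))

unique∧set⇒length : ∀ {A : Set} {xs ys : List A} → Unique xs → Unique ys →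
                    (∀ {z} → z ∈ xs → z ∈ ys) → (∀ {z} → z ∈ ys → z ∈ xs) →
                    length xs ≡ length ys
unique∧set⇒length !xs !ys xs⊆ys ys⊆xs =
  ↭-length (∼bag⇒↭ (unique∧set⇒bag !xs !ys (mk⇔ xs⊆ys ys⊆xs)))

unique⇒length≤ : ∀ {N} {xs : List (Fin N)} → Unique xs → length xs ≤ N
unique⇒length≤ {N} {xs} !xs = subst (_≤ N)
  (sym (unique∧set⇒length !xs (filter⁺ (_∈? xs) (allFin⁺ N))
    (λ z∈xs → ∈-filter⁺ (_∈? xs) (∈-allFin _) z∈xs)
    (λ z∈ys → proj₂ (∈-filter⁻ (_∈? xs) {xs = allFin N} z∈ys))))
  (≤-trans (length-filter (_∈? xs) (allFin N)) (≤-reflexive (length-tabulate {n = N} (λ x → x))))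
  where open DecMembership (_≟ᶠ_ {N}) using (_∈?_)

iterate-mono : ∀ {A : Set} (f : A → A) {x z m n} → m ≤ n → z ∈ iterate f x m → z ∈ iterate f x n
iterate-mono f (s≤s m≤n) (here e) = here e
iterate-mono f (s≤s m≤n) (there p) = there (iterate-mono f m≤n p)

iterate-stable : ∀ {A : Set} (f : A → A) (P : A → Set) → (∀ {z} → P z → P (f z)) →
                 ∀ {x z} N → P x → z ∈ iterate f x N → P z
iterate-stable f P P-f (suc N) Px (here refl) = Px
iterate-stable f P P-f (suc N) Px (there p) = iterate-stable f P P-f N (P-f Px) p

module _ {N} {σ : Permutation′ N} where
  private
    f = σ ⟨$⟩ʳ_
    Return₁ = Return f (const 1)

  Return-∈ : ∀ {t x y n} → Return₁ t x n → y ∈ iterate f x n → ∃ λ m → m ≤ n × Return₁ t y m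
  Return-∈ p@(stop _) (here refl) = _ , ≤-refl , p
  Return-∈ p@(step _ _) (here refl) = _ , ≤-refl , p
  Return-∈ (step _ p) (there y∈) with m , m≤n , q ← Return-∈ p y∈ = m , ≤-trans m≤n (n≤1+n _) , q

  -- A point occurring twice in the list would reach `t` after two different numbers of steps.
  Return-Unique : ∀ {t x n} → Return₁ t x n → Unique (iterate f x n)
  Return-Unique (stop _) = All.[] ∷ []
  Return-Unique p@(step _ q) = All.tabulate (λ { y∈ refl → let m , m≤n , r = Return-∈ q y∈ in
    <-irrefl (Return-unique r p) (s≤s m≤n) }) ∷ Return-Unique q

  Return-closed : ∀ {t x z n} → Return₁ t x n → z ∈ iterate f x n → f z ≡ t ⊎ f z ∈ iterate f x n
  Return-closed (stop e) (here refl) = inj₁ e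
  Return-closed (step _ (stop _)) (here refl) = inj₂ (there (here refl))
  Return-closed (step _ (step _ _)) (here refl) = inj₂ (there (here refl))
  Return-closed (step _ p) (there z∈) = [ inj₁ , inj₂ ∘ there ]′ (Return-closed p z∈)

  Return-start : ∀ {t x n} → Return₁ t x n → x ∈ iterate f x n
  Return-start (stop _) = here refl
  Return-start (step _ _) = here refl

  -- Both lists are duplicate-free. The orbit up to the return is closed under `f`, so it contains
  -- all `N` iterates; conversely `n ≤ N`.
  Return⇒cycleLength : ∀ {x n} → Return₁ x x n → cycleLength σ x ≡ n
  Return⇒cycleLength {x} {n} p = trans
    (unique∧set⇒length (deduplicate-! _≟ᶠ_ (iterate f x N)) (Return-Unique p)
      (λ z∈ → iterate-stable f (_∈ iterate f x n) closed N (Return-start p)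
                (∈-deduplicate⁻ _≟ᶠ_ (iterate f x N) z∈))
      (λ z∈ → ∈-deduplicate⁺ _≟ᶠ_ (iterate-mono f n≤N z∈)))
    (length-iterate f x n)
    where
    n≤N : n ≤ N
    n≤N = subst (_≤ N) (length-iterate f x n) (unique⇒length≤ (Return-Unique p))

    closed : ∀ {z} → z ∈ iterate f x n → f z ∈ iterate f x n
    closed z∈ with Return-closed p z∈
    ... | inj₁ e = subst (_∈ iterate f x n) (sym e) (Return-start p)
    ... | inj₂ q = q

-- Deleting a point from a permutation

data Split {n} (c : Fin (suc n)) : Fin (suc n) → Set where
  self  : Split c c
  other : ∀ y → Split c (punchIn c y)

split : ∀ {n} (c x : Fin (suc n)) → Split c x
split c x with c ≟ᶠ x
... | yes refl = self
... | no c≢x = subst (Split c) (punchIn-punchOut c≢x) (other _)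

⟨$⟩ʳ-injective : ∀ {n} (σ : Permutation′ n) → Injective _≡_ _≡_ (σ ⟨$⟩ʳ_)
⟨$⟩ʳ-injective σ = Injection.injective (↔⇒↣ σ)

module _ {n} (i j : Fin n) where

  transpose-left : transpose i j ⟨$⟩ʳ i ≡ j
  transpose-left rewrite dec-true (i ≟ᶠ i) refl = refl

  transpose-right : transpose i j ⟨$⟩ʳ j ≡ i
  transpose-right with j ≟ᶠ i
  ... | yes j≡i = j≡i
  ... | no _ rewrite dec-true (j ≟ᶠ j) refl = refl

  transpose-other : ∀ {k} → k ≢ i → k ≢ j → transpose i j ⟨$⟩ʳ k ≡ k
  transpose-other {k} k≢i k≢j
    rewrite dec-false (k ≟ᶠ i) k≢i | dec-false (k ≟ᶠ j) k≢j = refl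

  transpose-involutive : ∀ k → transpose i j ⟨$⟩ʳ (transpose i j ⟨$⟩ʳ k) ≡ k
  transpose-involutive k = go (k ≟ᶠ i) (k ≟ᶠ j)
    where
    go : Dec (k ≡ i) → Dec (k ≡ j) → transpose i j ⟨$⟩ʳ (transpose i j ⟨$⟩ʳ k) ≡ k
    go (yes refl) _ = trans (cong (transpose i j ⟨$⟩ʳ_) transpose-left) transpose-right
    go (no _) (yes refl) = trans (cong (transpose i j ⟨$⟩ʳ_) transpose-right) transpose-left
    go (no k≢i) (no k≢j) = trans (cong (transpose i j ⟨$⟩ʳ_) fixed) fixed
      where fixed = transpose-other k≢i k≢j

insert-self : ∀ {n} c (τ : Permutation′ n) → insert c c τ ⟨$⟩ʳ c ≡ c
insert-self c τ with c ≟ᶠ c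
... | yes _  = refl
... | no c≢c = contradiction refl c≢c

-- Inserts c into the cycle of c′ under τ, between c′ and its image.
insertAfter : ∀ {n} → Fin (suc n) → Fin n → Permutation′ n → Permutation′ (suc n)
insertAfter c c′ τ = transpose c (punchIn c c′) ∘ₚ insert c c τ

-- g is obtained from f by deleting c, whose predecessor is c′.
record Contraction {n} (f : Fin (suc n) → Fin (suc n)) (c : Fin (suc n))
                   (g : Fin n → Fin n) (c′ : Fin n) : Set where
  field
    at-c  : f c ≡ punchIn c (g c′)
    at-c′ : f (punchIn c c′) ≡ c
    away  : ∀ {y} → y ≢ c′ → f (punchIn c y) ≡ punchIn c (g y)

open Contraction

insertAfter-contraction : ∀ {n} c c′ (τ : Permutation′ n) →
                          Contraction (insertAfter c c′ τ ⟨$⟩ʳ_) c (τ ⟨$⟩ʳ_) c′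
insertAfter-contraction c c′ τ = record
  { at-c  = trans (cong (insert c c τ ⟨$⟩ʳ_) (transpose-left c (punchIn c c′)))
                  (insert-punchIn c c τ c′)
  ; at-c′ = trans (cong (insert c c τ ⟨$⟩ʳ_) (transpose-right c (punchIn c c′))) (insert-self c τ)
  ; away  = λ {y} y≢c′ →
      trans (cong (insert c c τ ⟨$⟩ʳ_)
              (transpose-other c (punchIn c c′) (punchInᵢ≢i c y) (y≢c′ ∘ punchIn-injective c y c′)))
            (insert-punchIn c c τ y)
  }

Contraction-cong : ∀ {n} {f f′ : Fin (suc n) → Fin (suc n)} {c g c′} → f ≗ f′ →
                   Contraction f c g c′ → Contraction f′ c g c′
Contraction-cong f≗f′ C = record
  { at-c  = trans (sym (f≗f′ _)) (at-c C)
  ; at-c′ = trans (sym (f≗f′ _)) (at-c′ C)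
  ; away  = λ y≢c′ → trans (sym (f≗f′ _)) (away C y≢c′)
  }

Contraction-unique : ∀ {n} {f f′ : Fin (suc n) → Fin (suc n)} {c g g′ c′} → f ≗ f′ →
                     Contraction f c g c′ → Contraction f′ c g′ c′ → g ≗ g′
Contraction-unique {c = c} {c′ = c′} f≗f′ C C′ y with y ≟ᶠ c′
... | yes refl = punchIn-injective c _ _ (trans (sym (at-c C)) (trans (f≗f′ _) (at-c C′)))
... | no y≢c′ = punchIn-injective c _ _ (trans (sym (away C y≢c′)) (trans (f≗f′ _) (away C′ y≢c′)))

Contraction-invariant : ∀ {n} {C : Set} {f : Fin (suc n) → Fin (suc n)} {c g c′}
                          {h : Fin (suc n) → C} →
                        Contraction f c g c′ → (∀ x → h (f x) ≡ h x) →
                        ∀ y → h (punchIn c (g y)) ≡ h (punchIn c y)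
Contraction-invariant {c = c} {c′ = c′} {h = h} C inv y with y ≟ᶠ c′
... | yes refl =
  trans (cong h (sym (at-c C))) (trans (inv c) (trans (cong h (sym (at-c′ C))) (inv _)))
... | no y≢c′ = trans (cong h (sym (away C y≢c′))) (inv _)

-- Swapping `c` with its predecessor before applying `σ` makes `c` a fixed point, which `remove`
-- deletes; a second swap restores `σ`.
contract : ∀ {n} (σ : Permutation′ (suc n)) {c} → σ ⟨$⟩ʳ c ≢ c →
           ∃ λ τ → ∃ λ c′ → insertAfter c c′ τ ≈ σ
contract σ {c} σc≢c = remove c ρ , punchOut c≢p , eq
  where
  p = σ ⟨$⟩ˡ c
  c≢p : c ≢ p
  c≢p c≡p = σc≢c (trans (cong (σ ⟨$⟩ʳ_) c≡p) (inverseʳ σ))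
  ρ = transpose c p ∘ₚ σ
  ρc≡c : ρ ⟨$⟩ʳ c ≡ c
  ρc≡c = trans (cong (σ ⟨$⟩ʳ_) (transpose-left c p)) (inverseʳ σ)
  eq : insertAfter c (punchOut c≢p) (remove c ρ) ≈ σ
  eq x rewrite punchIn-punchOut c≢p =
    trans (subst (λ d → insert c d (remove c ρ) ≈ ρ) ρc≡c (insert-remove c ρ)
            (transpose c p ⟨$⟩ʳ x))
          (cong (σ ⟨$⟩ʳ_) (transpose-involutive c p x))

remove-fixed : ∀ {n} (σ : Permutation′ (suc n)) {c} → σ ⟨$⟩ʳ c ≡ c →
               ∀ y → σ ⟨$⟩ʳ punchIn c y ≡ punchIn c (remove c σ ⟨$⟩ʳ y)
remove-fixed σ {c} σc≡c y =
  trans (punchIn-permute σ c y) (cong (λ d → punchIn d (remove c σ ⟨$⟩ʳ y)) σc≡c)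

-- Return times under deletion of a point

Return-fixed : ∀ {n} {f : Fin (suc n) → Fin (suc n)} {c} {g : Fin n → Fin n} {w w′ t y m} →
               (∀ y → f (punchIn c y) ≡ punchIn c (g y)) → (∀ y → w (punchIn c y) ≡ w′ y) →
               Return g w′ t y m → Return f w (punchIn c t) (punchIn c y) m
Return-fixed {f = f} {c} {w = w} {t = t} f≗g w≗w′ (stop {x} e) =
  subst (Return f w (punchIn c t) _) (w≗w′ x) (stop (trans (f≗g x) (cong (punchIn c) e)))
Return-fixed {f = f} {c} {w = w} {t = t} f≗g w≗w′ (step {x} {n = n} ne p) =
  subst (Return f w (punchIn c t) _) (cong (_+ n) (w≗w′ x))
    (step (ne ∘ punchIn-injective c _ _ ∘ trans (sym (f≗g x)))
      (subst (λ z → Return f w (punchIn c t) z n) (sym (f≗g x)) (Return-fixed f≗g w≗w′ p)))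

-- The weight suc s of c accounts for the s points already deleted from its cycle.
weight : ∀ {n} → Fin (suc n) → ℕ → Fin (suc n) → ℕ
weight c s = insertAt (const 1) c (suc s)

weight-self : ∀ {n} (c : Fin (suc n)) s → weight c s c ≡ suc s
weight-self c s = insertAt-lookup (const 1) c (suc s)

weight-punchIn : ∀ {n} (c : Fin (suc n)) s y → weight c s (punchIn c y) ≡ 1
weight-punchIn c s y = insertAt-punchIn (const 1) c (suc s) y

weight-other : ∀ {n} {c : Fin (suc n)} {s y} → y ≢ c → weight c s y ≡ 1
weight-other {c = c} {s} {y} y≢c with split c y
... | self = contradiction refl y≢c
... | other z = weight-punchIn c s z

weight-0 : ∀ {n} (c y : Fin (suc n)) → weight c 0 y ≡ 1
weight-0 c y with split c y
... | self = weight-self c 0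
... | other z = weight-punchIn c 0 z

weight-close : ∀ {n} (c : Fin (suc (suc n))) s y → weight c s (punchIn c y) ≡ weight zero 0 y
weight-close c s y = trans (weight-punchIn c s y) (sym (weight-0 zero y))

-- Where `g` leaves `c′` in one step, `f` makes a detour through `c`. The weight `suc (suc s)` of
-- `c′` pays for both points: 1 for `punchIn c c′` and `suc s` for `c`.
Return-contraction : ∀ {n} {f : Fin (suc (suc n)) → _} {c g c′} {s t y m} →
                     Contraction f c g c′ →
                     Return g (weight c′ (suc s)) t y m →
                     Return f (weight c s) (punchIn c t) (punchIn c y) m
Return-contraction {f = f} {c} {g} {c′} {s} {t} C = go
  where
  Return′ = Return f (weight c s) (punchIn c t)
  detour≢ : ∀ {y} → f (punchIn c c′) ≢ punchIn c y
  detour≢ {y} e = punchInᵢ≢i c y (trans (sym e) (at-c′ C))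

  through : ∀ {m} → Return′ c (suc s + m) → Return′ (punchIn c c′) (weight c′ (suc s) c′ + m)
  through {m} p = subst (Return′ (punchIn c c′))
    (trans (cong (_+ (suc s + m)) (weight-punchIn c s c′))
           (cong (_+ m) (sym (weight-self c′ (suc s)))))
    (step detour≢ (subst (λ z → Return′ z (suc s + m)) (sym (at-c′ C)) p))

  same-weight : ∀ {y} → y ≢ c′ → weight c s (punchIn c y) ≡ weight c′ (suc s) y
  same-weight {y} y≢c′ = trans (weight-punchIn c s y) (sym (weight-other y≢c′))

  go : ∀ {y m} → Return g (weight c′ (suc s)) t y m → Return′ (punchIn c y) m
  go (stop {y} e) with y ≟ᶠ c′
  ... | no y≢c′ = subst (Return′ _) (same-weight y≢c′)
    (stop (trans (away C y≢c′) (cong (punchIn c) e)))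
  ... | yes refl = subst (Return′ _) (+-identityʳ _)
    (through (subst (Return′ c) (trans (weight-self c s) (sym (+-identityʳ (suc s))))
      (stop (trans (at-c C) (cong (punchIn c) e)))))
  go (step {y} {m} ne p) with y ≟ᶠ c′
  ... | no y≢c′ = subst (Return′ _) (cong (_+ m) (same-weight y≢c′))
    (step (ne ∘ punchIn-injective c _ _ ∘ trans (sym (away C y≢c′)))
      (subst (λ z → Return′ z m) (sym (away C y≢c′)) (go p)))
  ... | yes refl = through (subst (Return′ c) (cong (_+ m) (weight-self c s))
    (step (ne ∘ punchIn-injective c _ _ ∘ trans (sym (at-c C)))
      (subst (λ z → Return′ z m) (sym (at-c C)) (go p))))

-- Codes and their decoding into coloured permutations

-- With suc M points left and s points of the current cycle already deleted,
-- closing that cycle gives it length suc s; its label lies in F₀ s, and the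
-- labels of all later cycles are taken from F.  The separate F₀ allows the
-- length of the first cycle to be restricted.
Code : (F₀ F : ℕ → Set) → ℕ → ℕ → Set
Code F₀ F s zero    = F₀ s
Code F₀ F s (suc M) = (F₀ s × Code F F 0 M) ⊎ (Fin (suc M) × Code F₀ F (suc s) M)

-- One less than the length of the first cycle.
gap : ∀ {F₀ F} s M → Code F₀ F s M → ℕ
gap s zero    _              = s
gap s (suc M) (inj₁ _)       = s
gap s (suc M) (inj₂ (_ , k)) = gap (suc s) M k

-- A common form of both sides: regular permutations get the single colour of `⊤`, enriched ones a
-- colour in `Fin p`.
record Coloured (C : Set) (D : ℕ → Set) (N : ℕ) : Set where
  field
    perm        : Permutation′ N
    lengths     : ∀ x → D (cycleLength perm x)
    colour      : Fin N → C
    colour-cong : ∀ x → colour (perm ⟨$⟩ʳ x) ≡ colour x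

module _ {C : Set} {D : ℕ → Set} (D? : ∀ n → Dec (D n)) where

  -- `True` has at most one element, so equal permutations and colours have equal codes, and labels
  -- can be counted.
  Label : ℕ → Set
  Label s = True (D? (suc s)) × C

  private
    K = Code Label Label

  decode : ∀ s M → Fin (suc M) → K s M → Permutation′ (suc M)
  decode s zero    c _               = id
  decode s (suc M) c (inj₁ (_ , k))  = insert c c (decode 0 M zero k)
  decode s (suc M) c (inj₂ (c′ , k)) = insertAfter c c′ (decode (suc s) M c′ k)

  decodeColour : ∀ s M → Fin (suc M) → K s M → Fin (suc M) → C
  decodeColour s zero    c (_ , a)              = const a
  decodeColour s (suc M) c (inj₁ ((_ , a) , k)) = insertAt (decodeColour 0 M zero k) c a
  decodeColour s (suc M) c (inj₂ (c′ , k))      = insertAt h c (h c′)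
    where h = decodeColour (suc s) M c′ k

  decodeColour-cong : ∀ s M c k x →
    decodeColour s M c k (decode s M c k ⟨$⟩ʳ x) ≡ decodeColour s M c k x
  decodeColour-cong s zero c _ x = refl
  decodeColour-cong s (suc M) c (inj₁ ((_ , a) , k)) x with split c x
  ... | self = cong (insertAt (decodeColour 0 M zero k) c a) (insert-self c (decode 0 M zero k))
  ... | other y = trans (cong (insertAt h c a) (insert-punchIn c c (decode 0 M zero k) y))
    (trans (insertAt-punchIn h c a _)
      (trans (decodeColour-cong 0 M zero k y) (sym (insertAt-punchIn h c a y))))
    where h = decodeColour 0 M zero k
  decodeColour-cong s (suc M) c (inj₂ (c′ , k)) x = go (split c x)
    where
    h = decodeColour (suc s) M c′ k
    ct = insertAfter-contraction c c′ (decode (suc s) M c′ k)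
    H = insertAt h c (h c′)
    H-punchIn : ∀ y → H (punchIn c y) ≡ h y
    H-punchIn = insertAt-punchIn h c (h c′)
    H-self : H c ≡ h c′
    H-self = insertAt-lookup h c (h c′)
    go : ∀ {x} → Split c x → H (decode s (suc M) c (inj₂ (c′ , k)) ⟨$⟩ʳ x) ≡ H x
    go self = trans (cong H (at-c ct))
      (trans (H-punchIn _) (trans (decodeColour-cong (suc s) M c′ k c′) (sym H-self)))
    go (other y) with y ≟ᶠ c′
    ... | yes refl = trans (cong H (at-c′ ct)) (trans H-self (sym (H-punchIn _)))
    ... | no y≢c′  = trans (cong H (away ct y≢c′))
      (trans (H-punchIn _) (trans (decodeColour-cong (suc s) M c′ k y) (sym (H-punchIn _))))

  -- Each deletion hands the weight of the deleted point on to its predecessor, so the weighted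
  -- length of the current cycle is kept until that cycle is closed at a single point. At `s = 0`
  -- all weights are 1 and this is the true length.
  Return-decode-current : ∀ s M c k →
    Return (decode s M c k ⟨$⟩ʳ_) (weight c s) c c (suc (gap s M k))
  Return-decode-current s zero zero k = stop refl
  Return-decode-current s (suc M) c (inj₁ (_ , k)) =
    subst (Return _ _ c c) (weight-self c s) (stop (insert-self c _))
  Return-decode-current s (suc M) c (inj₂ (c′ , k)) =
    Return-rotate (⟨$⟩ʳ-injective (insertAfter c c′ _)) (at-c′ ct) (punchInᵢ≢i c c′ ∘ sym)
      (Return-contraction ct (Return-decode-current (suc s) M c′ k))
    where ct = insertAfter-contraction c c′ (decode (suc s) M c′ k)

  Return-decode : ∀ s M c k x → ∃ λ n → Return (decode s M c k ⟨$⟩ʳ_) (weight c s) x x n × D n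
  Return-decode s zero zero (l , _) zero = _ , stop refl , toWitness l
  Return-decode s (suc M) c (inj₁ ((l , _) , k)) x with split c x
  ... | self = _ , stop (insert-self c _) , subst D (sym (weight-self c s)) (toWitness l)
  ... | other y with n , p , d ← Return-decode 0 M zero k y =
    n , Return-fixed (insert-punchIn c c _) (weight-close c s) p , d
  Return-decode s (suc M) c (inj₂ (c′ , k)) x with split c x
  ... | self with n , p , d ← Return-decode (suc s) M c′ k c′ =
      n , Return-rotate (⟨$⟩ʳ-injective (insertAfter c c′ _)) (at-c′ ct) (punchInᵢ≢i c c′ ∘ sym)
        (Return-contraction ct p) , d
    where ct = insertAfter-contraction c c′ (decode (suc s) M c′ k)
  ... | other y with n , p , d ← Return-decode (suc s) M c′ k y = n , Return-contraction ct p , d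
    where ct = insertAfter-contraction c c′ (decode (suc s) M c′ k)

  -- The permutation dictates every choice: `c` is fixed exactly if its cycle is closed now;
  -- otherwise the preimage of `c` is the chosen predecessor, and the contracted permutation is
  -- determined.
  decode-injective : ∀ s M c k k′ → decode s M c k ≈ decode s M c k′ →
                     decodeColour s M c k ≗ decodeColour s M c k′ → k ≡ k′
  decode-injective s zero c (l , a) (l′ , a′) _ e = cong₂ _,_ (T-irrelevant l l′) (e c)
  decode-injective s (suc M) c (inj₁ ((l , a) , k)) (inj₁ ((l′ , a′) , k′)) σ≈σ′ h≗h′ =
    cong inj₁ (cong₂ _,_ (cong₂ _,_ (T-irrelevant l l′)
        (trans (sym (insertAt-lookup _ c a)) (trans (h≗h′ c) (insertAt-lookup _ c a′))))
      (decode-injective 0 M zero k k′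
        (λ y → punchIn-injective c _ _ (trans (sym (insert-punchIn c c _ y))
                 (trans (σ≈σ′ _) (insert-punchIn c c _ y))))
        (λ y → trans (sym (insertAt-punchIn _ c a y))
                 (trans (h≗h′ _) (insertAt-punchIn _ c a′ y)))))
  decode-injective s (suc M) c (inj₁ (_ , k)) (inj₂ (c′ , k′)) σ≈σ′ _ =
    contradiction
      (trans (sym (at-c (insertAfter-contraction c c′ _))) (trans (sym (σ≈σ′ c)) (insert-self c _)))
      (punchInᵢ≢i c _)
  decode-injective s (suc M) c (inj₂ (c′ , k)) (inj₁ (_ , k′)) σ≈σ′ _ =
    contradiction
      (trans (sym (at-c (insertAfter-contraction c c′ _))) (trans (σ≈σ′ c) (insert-self c _)))
      (punchInᵢ≢i c _)
  decode-injective s (suc M) c (inj₂ (c₁ , k)) (inj₂ (c₂ , k′)) σ≈σ′ h≗h′ =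
    descend same k k′ σ≈σ′ h≗h′
    where
    same : c₁ ≡ c₂
    same = punchIn-injective c _ _ (⟨$⟩ʳ-injective (decode s (suc M) c (inj₂ (c₁ , k)))
      (trans (at-c′ (insertAfter-contraction c c₁ _))
        (sym (trans (σ≈σ′ (punchIn c c₂)) (at-c′ (insertAfter-contraction c c₂ _))))))
    descend : c₁ ≡ c₂ → ∀ k k′ →
              decode s (suc M) c (inj₂ (c₁ , k)) ≈ decode s (suc M) c (inj₂ (c₂ , k′)) →
              decodeColour s (suc M) c (inj₂ (c₁ , k)) ≗ decodeColour s (suc M) c (inj₂ (c₂ , k′)) →
              _≡_ {A = K s (suc M)} (inj₂ (c₁ , k)) (inj₂ (c₂ , k′))
    descend refl k k′ σ≈σ′ h≗h′ = cong (λ k → inj₂ (c₁ , k)) (decode-injective (suc s) M c₁ k k′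
      (Contraction-unique σ≈σ′ (insertAfter-contraction c c₁ _) (insertAfter-contraction c c₁ _))
      (λ y → trans (sym (insertAt-punchIn _ c _ y)) (trans (h≗h′ _) (insertAt-punchIn _ c _ y))))

  -- A fixed current point is closed, any other is contracted into its predecessor. The hypothesis
  -- on weighted return times passes to the smaller permutation and provides the label at each
  -- closing.
  decode-surjective : ∀ s M c (σ : Permutation′ (suc M)) (h : Fin (suc M) → C) →
                      (∀ x → h (σ ⟨$⟩ʳ x) ≡ h x) →
                      (∀ {x n} → Return (σ ⟨$⟩ʳ_) (weight c s) x x n → D n) →
                      ∃ λ k → decode s M c k ≈ σ × decodeColour s M c k ≗ h
  decode-surjective s zero zero σ h inv len with σ ⟨$⟩ʳ zero in eq
  ... | zero = (fromWitness (len (stop eq)) , h zero) , (λ { zero → sym eq }) , (λ { zero → refl })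
  decode-surjective s (suc M) c σ h inv len with σ ⟨$⟩ʳ c ≟ᶠ c
  ... | yes σc≡c
    with k , τ≈ , h≗ ← decode-surjective 0 M zero (remove c σ) (h ∘ punchIn c)
      (λ y → trans (cong h (sym (remove-fixed σ σc≡c y))) (inv (punchIn c y)))
      (λ p → len (Return-fixed (remove-fixed σ σc≡c) (weight-close c s) p))
    = inj₁ ((fromWitness (subst D (weight-self c s) (len (stop σc≡c))) , h c) , k)
    , (λ x → perm≈ (split c x)) , λ x → colour≗ (split c x)
    where
    perm≈ : ∀ {x} → Split c x → insert c c (decode 0 M zero k) ⟨$⟩ʳ x ≡ σ ⟨$⟩ʳ x
    perm≈ self = trans (insert-self c _) (sym σc≡c)
    perm≈ (other y) = trans (insert-punchIn c c _ y)
      (trans (cong (punchIn c) (τ≈ y)) (sym (remove-fixed σ σc≡c y)))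
    colour≗ : ∀ {x} → Split c x → insertAt (decodeColour 0 M zero k) c (h c) x ≡ h x
    colour≗ self = insertAt-lookup _ c (h c)
    colour≗ (other y) = trans (insertAt-punchIn _ c (h c) y) (h≗ y)
  ... | no σc≢c
    with τ , c′ , σ≈ ← contract σ σc≢c
    with ct ← Contraction-cong σ≈ (insertAfter-contraction c c′ τ)
    with k , τ≈ , h≗ ← decode-surjective (suc s) M c′ τ (h ∘ punchIn c)
      (Contraction-invariant ct inv) (λ p → len (Return-contraction ct p))
    = inj₂ (c′ , k)
    , (λ x → trans (insert≈ (transpose c (punchIn c c′) ⟨$⟩ʳ x)) (σ≈ x))
    , λ x → colour≗ (split c x)
    where
    insert≈ : insert c c (decode (suc s) M c′ k) ≈ insert c c τ
    insert≈ x with split c x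
    ... | self = trans (insert-self c _) (sym (insert-self c τ))
    ... | other y = trans (insert-punchIn c c _ y)
      (trans (cong (punchIn c) (τ≈ y)) (sym (insert-punchIn c c τ y)))
    colour≗ : ∀ {x} → Split c x → decodeColour s (suc M) c (inj₂ (c′ , k)) x ≡ h x
    colour≗ self = trans (insertAt-lookup _ c _)
      (trans (h≗ c′) (trans (sym (inv (punchIn c c′))) (cong h (at-c′ ct))))
    colour≗ (other y) = trans (insertAt-punchIn _ c _ y) (h≗ y)

-- Counting codes

-- The last argument is the number of points left, so codes of index `M` are counted at `suc M`. The
-- value 1 at 0 stands for the empty remainder after the last closing; in the other summand it is
-- multiplied by 0.
count : (q₀ q : ℕ → ℕ) → ℕ → ℕ → ℕ
count q₀ q s zero    = 1
count q₀ q s (suc N) = q₀ s * count q q 0 N + N * count q₀ q (suc s) N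

-- Lets a full period of deleted points be forgotten; `q₀′` may differ from `q₀`, so that a
-- restriction on the first cycle is shifted too.
count-shift : ∀ {q₀ q₀′ : ℕ → ℕ} {q} d → (∀ x → q₀ (d + x) ≡ q₀′ x) →
              ∀ s N → count q₀ q (d + s) N ≡ count q₀′ q s N
count-shift d eq s zero = refl
count-shift {q₀} {q₀′} {q} d eq s (suc N) =
  cong₂ _+_ (cong (_* count q q 0 N) (eq s))
    (cong (N *_) (trans (cong (λ x → count q₀ q x N) (sym (+-suc d s)))
                     (count-shift d eq (suc s) N)))

-- (t + N - 1) ⋯ (N + 1) N
rising : ℕ → ℕ → ℕ
rising zero    N = 1
rising (suc t) N = (t + N) * rising t N

-- While closing is impossible every step is a deletion, and the numbers of available predecessors
-- multiply to `rising t N`.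
count-skip : ∀ {q₀ q} t s N → (∀ i → i < t → q₀ (i + s) ≡ 0) →
             count q₀ q s (t + N) ≡ rising t N * count q₀ q (t + s) N
count-skip zero s N _ = sym (*-identityˡ _)
count-skip {q₀} {q} (suc t) s N zeros = begin
  q₀ s * count q q 0 (t + N) + (t + N) * count q₀ q (suc s) (t + N)
    ≡⟨ cong₂ (λ u v → u * count q q 0 (t + N) + (t + N) * v) (zeros 0 z<s)
         (count-skip t (suc s) N λ i i<t → trans (cong q₀ (+-suc i s)) (zeros (suc i) (s<s i<t))) ⟩
  (t + N) * (rising t N * count q₀ q (t + suc s) N)
    ≡⟨ cong (λ x → (t + N) * (rising t N * count q₀ q x N)) (+-suc t s) ⟩
  (t + N) * (rising t N * count q₀ q (suc t + s) N)
    ≡⟨ assoc (t + N) (rising t N) _ ⟩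
  (t + N) * rising t N * count q₀ q (suc t + s) N ∎
  where
  assoc : ∀ a b c → a * (b * c) ≡ a * b * c
  assoc = solve-∀

-- The factor N accounts for the value 1 of count at N = 0.
count-never : ∀ {q₀ q} s N → (∀ i → q₀ (i + s) ≡ 0) → N * count q₀ q s N ≡ 0
count-never s zero _ = refl
count-never {q₀} {q} s (suc N) zeros = begin
  suc N * (q₀ s * count q q 0 N + N * count q₀ q (suc s) N)
    ≡⟨ cong₂ (λ u v → suc N * (u * count q q 0 N + v)) (zeros 0)
         (count-never (suc s) N λ i → trans (cong q₀ (+-suc i s)) (zeros (suc i))) ⟩
  suc N * 0 ≡⟨ *-zeroʳ (suc N) ⟩
  0 ∎

-- Here `p` is r - 1. Arguments of `ρ` and `γ` are one less than a cycle length, so `p` stands for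
-- length r: no regular label, and one singular label per colour.
module Counting (p : ℕ)
  {ρ γ : ℕ → ℕ}
  (ρ-period : ∀ x → ρ (suc p + x) ≡ ρ x) (ρ-small : ∀ {x} → x < p → ρ x ≡ 1) (ρ-last : ρ p ≡ 0)
  (γ-period : ∀ x → γ (suc p + x) ≡ γ x) (γ-small : ∀ {x} → x < p → γ x ≡ 0) (γ-last : γ p ≡ p)
  where

  private
    r : ℕ
    r = suc p

  regulars cycs : ℕ → ℕ → ℕ
  regulars = count ρ ρ
  cycs     = count γ γ

  module Block (N : ℕ) (flat : ∀ {s} → s < r → regulars s N ≡ regulars 0 N) where

    private
      a = regulars 0 N
      G : ℕ → ℕ
      G j = rising j (suc N)

    -- As `s + j < r`, closing is allowed at each of the `j` steps. Closing and deleting leave the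
    -- same count, so each step contributes one choice plus the number of predecessors.
    regulars-open : ∀ j s → s + j < r → regulars s (j + N) ≡ G j * a
    regulars-open zero s s<r = trans (flat (subst (_< r) (+-identityʳ s) s<r)) (sym (*-identityˡ a))
    regulars-open (suc j) s s+j<r = begin
      ρ s * regulars 0 (j + N) + (j + N) * regulars (suc s) (j + N)
        ≡⟨ cong₂ (λ u v → u * regulars 0 (j + N) + (j + N) * v)
             (ρ-small (s<s⁻¹ (≤-trans (s≤s (s≤s (m≤m+n s j))) ss<r)))
             (regulars-open j (suc s) ss<r) ⟩
      1 * regulars 0 (j + N) + (j + N) * (G j * a)
        ≡⟨ cong (λ u → 1 * u + (j + N) * (G j * a)) 
             (regulars-open j 0 (≤-trans (s≤s (≤-trans (m≤n+m j s) (n≤1+n _))) ss<r)) ⟩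
      1 * (G j * a) + (j + N) * (G j * a)
        ≡⟨ ring j N (G j) a ⟩
      (j + suc N) * G j * a ∎
      where
      ss<r : suc s + j < r
      ss<r = subst (_< r) (+-suc s j) s+j<r
      ring : ∀ j N g a → 1 * (g * a) + (j + N) * (g * a) ≡ (j + suc N) * g * a
      ring = solve-∀

    -- At `s = p` closing is forbidden, which costs one choice, and the deletion wraps `s` around to
    -- 0. For `s < p` closing is counted by `regulars-open`, deleting by induction, and the sum has
    -- the same form, so the value does not depend on `s`.
    regulars-closed : ∀ j s → s < r → r ≤ s + suc j → j < r →
                      regulars s (suc j + N) ≡ (j + N) * (G j * a)
    regulars-closed j s s<r r≤s+j j<r with s ≟ p
    ... | yes refl = begin
      ρ p * regulars 0 (j + N) + (j + N) * regulars r (j + N)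
        ≡⟨ cong₂ (λ u x → u * regulars 0 (j + N) + (j + N) * regulars x (j + N))
             ρ-last (sym (+-identityʳ r)) ⟩
      (j + N) * regulars (r + 0) (j + N)
        ≡⟨ cong ((j + N) *_) (trans (count-shift r ρ-period 0 (j + N)) (regulars-open j 0 j<r)) ⟩
      (j + N) * (G j * a) ∎
    -- Here `r ≤ s + 1`, which leaves only `s = p`.
    regulars-closed zero s s<r r≤s+j j<r | no s≢p
      with () ← s≢p (≤-antisym (s≤s⁻¹ s<r) (s≤s⁻¹ (subst (r ≤_) (+-comm s 1) r≤s+j)))
    regulars-closed (suc j) s s<r r≤s+j j<r | no s≢p = begin
      ρ s * regulars 0 (suc j + N) + (suc j + N) * regulars (suc s) (suc j + N)
        ≡⟨ cong₂ (λ u v → u * regulars 0 (suc j + N) + (suc j + N) * v) (ρ-small s<p)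
             (regulars-closed j (suc s) (s≤s s<p) (subst (r ≤_) (+-suc s (suc j)) r≤s+j)
               (<⇒≤ j<r)) ⟩
      1 * regulars 0 (suc j + N) + (suc j + N) * ((j + N) * (G j * a))
        ≡⟨ cong (λ u → 1 * u + (suc j + N) * ((j + N) * (G j * a))) (regulars-open (suc j) 0 j<r) ⟩
      1 * ((j + suc N) * G j * a) + (suc j + N) * ((j + N) * (G j * a))
        ≡⟨ ring j N (G j) a ⟩
      (suc j + N) * ((j + suc N) * G j * a) ∎
      where
      s<p : s < p
      s<p = ≤∧≢⇒< (s≤s⁻¹ s<r) s≢p
      ring : ∀ j N g a → 1 * ((j + suc N) * g * a) + (suc j + N) * ((j + N) * (g * a))
                       ≡ (suc j + N) * ((j + suc N) * g * a)
      ring = solve-∀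

    regulars-block : ∀ {s} → s < r → regulars s (r + N) ≡ (p + N) * (G p * a)
    regulars-block {s} s<r = regulars-closed p s s<r (m≤n+m r s) ≤-refl

    -- After `p` forced deletions there are `p` colours for closing or `N` predecessors for going
    -- on, and r deleted points count as none. The factor `p + N` is the one in `regulars-block`.
    cycs-block : cycs 0 (r + N) ≡ G p * (p * cycs 0 N + N * cycs 0 N)
    cycs-block = begin
      cycs 0 (suc p + N) ≡⟨ cong (cycs 0) (sym (+-suc p N)) ⟩
      cycs 0 (p + suc N)
        ≡⟨ count-skip p 0 (suc N) (λ i i<p → γ-small (subst (_< p) (sym (+-identityʳ i)) i<p)) ⟩
      G p * (γ (p + 0) * cycs 0 N + N * cycs (r + 0) N)
        ≡⟨ cong₂ (λ u v → G p * (u * cycs 0 N + N * v))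
             (trans (cong γ (+-identityʳ p)) γ-last) (count-shift r γ-period 0 N) ⟩
      G p * (p * cycs 0 N + N * cycs 0 N) ∎

    module First {ρ₀ γ₀ : ℕ → ℕ}
      (ρ₀-small : ∀ {x} → x < p → ρ₀ x ≡ 1) (ρ₀-last : ρ₀ p ≡ 0) (ρ₀-large : ∀ x → ρ₀ (r + x) ≡ 0)
      (γ₀-small : ∀ {x} → x < p → γ₀ x ≡ 0) (γ₀-last : γ₀ p ≡ p) (γ₀-large : ∀ x → γ₀ (r + x) ≡ 0)
      where

      private
        large : ∀ (q₀ : ℕ → ℕ) → (∀ x → q₀ (r + x) ≡ 0) → ∀ i → q₀ (i + r) ≡ 0
        large q₀ z i = trans (cong q₀ (+-comm i r)) (z i)

      -- Each of the `t` lengths still open to the first cycle contributes `G t * a`: the deletions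
      -- before closing and `regulars-open` after it together give the same product. For `t = p`
      -- these `p` lengths match the `p` colours in `cycs-first`.
      regulars-first : ∀ t s → s + t ≡ p → count ρ₀ ρ s (suc t + N) ≡ t * (G t * a)
      regulars-first zero s s≡p = begin
        ρ₀ s * regulars 0 N + N * count ρ₀ ρ (suc s) N
          ≡⟨ cong (λ s → ρ₀ s * regulars 0 N + N * count ρ₀ ρ (suc s) N)
               (trans (sym (+-identityʳ s)) s≡p) ⟩
        ρ₀ p * regulars 0 N + N * count ρ₀ ρ r N
          ≡⟨ cong₂ (λ u v → u * regulars 0 N + v) ρ₀-last (count-never r N (large ρ₀ ρ₀-large)) ⟩
        0 ∎
      regulars-first (suc t) s s+t≡p = begin
        ρ₀ s * regulars 0 (suc t + N) + (suc t + N) * count ρ₀ ρ (suc s) (suc t + N)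
          ≡⟨ cong₂ (λ u v → u * regulars 0 (suc t + N) + (suc t + N) * v)
               (ρ₀-small (≤-trans (s≤s (m≤m+n s t)) (≤-reflexive eq)))
               (regulars-first t (suc s) eq) ⟩
        1 * regulars 0 (suc t + N) + (suc t + N) * (t * (G t * a))
          ≡⟨ cong (λ u → 1 * u + (suc t + N) * (t * (G t * a)))
               (regulars-open (suc t) 0 (s≤s (≤-trans (m≤n+m (suc t) s) (≤-reflexive s+t≡p)))) ⟩
        1 * ((t + suc N) * G t * a) + (suc t + N) * (t * (G t * a))
          ≡⟨ ring t N (G t) a ⟩
        suc t * ((t + suc N) * G t * a) ∎
        where
        eq : suc s + t ≡ p
        eq = trans (sym (+-suc s t)) s+t≡p
        ring : ∀ t N g a → 1 * ((t + suc N) * g * a) + (suc t + N) * (t * (g * a))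
                         ≡ suc t * ((t + suc N) * g * a)
        ring = solve-∀

      cycs-first : count γ₀ γ 0 (r + N) ≡ p * (G p * cycs 0 N)
      cycs-first = begin
        count γ₀ γ 0 (suc p + N) ≡⟨ cong (count γ₀ γ 0) (sym (+-suc p N)) ⟩
        count γ₀ γ 0 (p + suc N)
          ≡⟨ count-skip p 0 (suc N) (λ i i<p → γ₀-small (subst (_< p) (sym (+-identityʳ i)) i<p)) ⟩
        G p * (γ₀ (p + 0) * cycs 0 N + N * count γ₀ γ (r + 0) N)
          ≡⟨ cong (λ x → G p * (γ₀ x * cycs 0 N + N * count γ₀ γ (suc x) N)) (+-identityʳ p) ⟩
        G p * (γ₀ p * cycs 0 N + N * count γ₀ γ r N)
          ≡⟨ cong₂ (λ u v → G p * (u * cycs 0 N + v)) γ₀-last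
               (count-never r N (large γ₀ γ₀-large)) ⟩
        G p * (p * cycs 0 N + 0) ≡⟨ ring (G p) p (cycs 0 N) ⟩
        p * (G p * cycs 0 N) ∎
        where
        ring : ∀ g p c → g * (p * c + 0) ≡ p * (g * c)
        ring = solve-∀

  regulars-flat : ∀ n {s} → s < r → regulars s (n * r) ≡ regulars 0 (n * r)
  regulars-flat zero s<r = refl
  regulars-flat (suc n) s<r = trans (regulars-block s<r) (sym (regulars-block z<s))
    where open Block (n * r) (regulars-flat n)

  regulars≡cycs : ∀ n → regulars 0 (n * r) ≡ cycs 0 (n * r)
  regulars≡cycs zero = refl
  regulars≡cycs (suc n) = begin
    regulars 0 (r + n * r)                                        ≡⟨ regulars-block z<s ⟩
    (p + n * r) * (rising p (suc (n * r)) * regulars 0 (n * r))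
      ≡⟨ cong (λ u → (p + n * r) * (rising p (suc (n * r)) * u)) (regulars≡cycs n) ⟩
    (p + n * r) * (rising p (suc (n * r)) * cycs 0 (n * r))
      ≡⟨ ring p (n * r) (rising p (suc (n * r))) (cycs 0 (n * r)) ⟩
    rising p (suc (n * r)) * (p * cycs 0 (n * r) + n * r * cycs 0 (n * r)) ≡⟨ sym cycs-block ⟩
    cycs 0 (r + n * r) ∎
    where
    open Block (n * r) (regulars-flat n)
    ring : ∀ p N g c → (p + N) * (g * c) ≡ g * (p * c + N * c)
    ring = solve-∀

  -- e g is the indicator of the block g r, …, g r + r - 1.
  module Graded (e : ℕ → ℕ → ℕ)
    (e-zero : ∀ {x} → x < r → e 0 x ≡ 1) (e-zero-large : ∀ x → e 0 (r + x) ≡ 0)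
    (e-suc : ∀ g {x} → x < r → e (suc g) x ≡ 0) (e-period : ∀ g x → e (suc g) (r + x) ≡ e g x)
    where

    _at_ : (ℕ → ℕ) → ℕ → ℕ → ℕ
    (q at g) x = q x * e g x

    private
      at-zero : ∀ (q : ℕ → ℕ) {x v} → q x ≡ v → x < r → (q at 0) x ≡ v
      at-zero q {v = v} qx≡v x<r = trans (cong₂ _*_ qx≡v (e-zero x<r)) (*-identityʳ v)

      at-zero-large : ∀ q x → (q at 0) (r + x) ≡ 0
      at-zero-large q x = trans (cong (q (r + x) *_) (e-zero-large x)) (*-zeroʳ (q (r + x)))

      -- A first cycle beyond block 0 starts with r forced deletions, after which the labels repeat
      -- and its block index has dropped by one.
      peel : ∀ q → (∀ x → q (r + x) ≡ q x) → ∀ g N →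
             count (q at suc g) q 0 (r + N) ≡ rising r N * count (q at g) q 0 N
      peel q q-period g N = trans
        (count-skip r 0 N λ i i<r → trans (cong (q (i + 0) *_)
          (e-suc g (subst (_< r) (sym (+-identityʳ i)) i<r))) (*-zeroʳ (q (i + 0))))
        (cong (rising r N *_) (count-shift r (λ x → cong₂ _*_ (q-period x) (e-period g x)) 0 N))

    graded-counts : ∀ n g → count (ρ at g) ρ 0 (n * r) ≡ count (γ at g) γ 0 (n * r)
    -- Both sides have the default value 1; when this case is reached through `peel`, the factor
    -- `rising r 0` is 0.
    graded-counts zero g = refl
    graded-counts (suc n) zero = begin
      count (ρ at 0) ρ 0 (r + n * r)                       ≡⟨ regulars-first p 0 refl ⟩
      p * (rising p (suc (n * r)) * regulars 0 (n * r))
        ≡⟨ cong (λ u → p * (rising p (suc (n * r)) * u)) (regulars≡cycs n) ⟩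
      p * (rising p (suc (n * r)) * cycs 0 (n * r))        ≡⟨ sym cycs-first ⟩
      count (γ at 0) γ 0 (r + n * r) ∎
      where
      open Block (n * r) (regulars-flat n)
      small : ∀ {x} → x < p → x < r
      small x<p = ≤-trans x<p (n≤1+n p)
      open First {ρ at 0} {γ at 0}
        (λ x<p → at-zero ρ (ρ-small x<p) (small x<p)) (at-zero ρ ρ-last ≤-refl) (at-zero-large ρ)
        (λ x<p → at-zero γ (γ-small x<p) (small x<p)) (at-zero γ γ-last ≤-refl) (at-zero-large γ)
    graded-counts (suc n) (suc g) = begin
      count (ρ at suc g) ρ 0 (r + n * r)
        ≡⟨ peel ρ ρ-period g (n * r) ⟩
      rising r (n * r) * count (ρ at g) ρ 0 (n * r)
        ≡⟨ cong (rising r (n * r) *_) (graded-counts n g) ⟩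
      rising r (n * r) * count (γ at g) γ 0 (n * r)
        ≡⟨ sym (peel γ γ-period g (n * r)) ⟩
      count (γ at suc g) γ 0 (r + n * r) ∎

-- From counts to bijections

ColouredPermutation : (C : Set) (D : ℕ → Set) (N : ℕ) → Setoid 0ℓ 0ℓ
ColouredPermutation C D N = record
  { Carrier       = Coloured C D N
  ; _≈_           = λ σ τ → perm σ ≈ perm τ × colour σ ≗ colour τ
  ; isEquivalence = record
    { refl  = (λ _ → refl) , λ _ → refl
    ; sym   = λ (p , c) → (λ x → sym (p x)) , λ x → sym (c x)
    ; trans = λ (p , c) (q , d) → (λ x → trans (p x) (q x)) , λ x → trans (c x) (d x)
    }
  }
  where open Coloured

Return⇒length : ∀ {M} {σ : Permutation′ (suc M)} {x l} →
                Return (σ ⟨$⟩ʳ_) (weight zero 0) x x l → cycleLength σ x ≡ l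
Return⇒length {σ = σ} = Return⇒cycleLength {σ = σ} ∘ Return-cong (λ _ → refl) (weight-0 zero)

module _ {C : Set} {D : ℕ → Set} (D? : ∀ n → Dec (D n)) (M : ℕ) where
  private
    L = Label {C = C} D?

  toColoured : Code L L 0 M → Coloured C D (suc M)
  toColoured k = record
    { perm        = decode D? 0 M zero k
    ; lengths     = lengths
    ; colour      = decodeColour D? 0 M zero k
    ; colour-cong = decodeColour-cong D? 0 M zero k
    }
    where
    lengths : ∀ x → D (cycleLength (decode D? 0 M zero k) x)
    lengths x with _ , p , d ← Return-decode D? 0 M zero k x =
      subst D (sym (Return⇒length {σ = decode D? 0 M zero k} p)) d

  toColoured-surjective : (σ : Coloured C D (suc M)) → ∃ λ k →
    decode D? 0 M zero k ≈ Coloured.perm σ × decodeColour D? 0 M zero k ≗ Coloured.colour σ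
  toColoured-surjective σ = decode-surjective D? 0 M zero perm colour colour-cong
    λ {x} p → subst D (Return⇒length {σ = perm} p) (lengths x)
    where open Coloured σ

  Code↔Coloured : Inverse (setoid (Code L L 0 M)) (ColouredPermutation C D (suc M))
  Code↔Coloured = Bijection⇒Inverse record
    { to        = toColoured
    ; cong      = λ { refl → (λ _ → refl) , λ _ → refl }
    ; bijective = (λ (p , c) → decode-injective D? 0 M zero _ _ p c)
                , λ σ → proj₁ (toColoured-surjective σ)
                      , λ { refl → proj₂ (toColoured-surjective σ) }
    }

  -- Stated up to `≈` because the code of a given permutation decodes to it only pointwise.
  cycleLength-decode : ∀ k {σ : Permutation′ (suc M)} → decode D? 0 M zero k ≈ σ →
                       cycleLength σ zero ≡ suc (gap {F₀ = L} {L} 0 M k)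
  cycleLength-decode k {σ} p =
    Return⇒length {σ = σ} (Return-cong p (λ _ → refl) (Return-decode-current D? 0 M zero k))

-- The gap depends only on where the first closing occurs, so a condition on it can be moved into
-- the label chosen there.
Code-fibre : ∀ {F₀ F : ℕ → Set} {E : ℕ → Set} s M →
             ∃ (E ∘ gap {F₀} {F} s M) ↔ Code (λ x → F₀ x × E x) F s M
Code-fibre s zero = ↔-id _
Code-fibre {F₀} {F} {E} s (suc M) = mk↔ₛ′ to from to∘from from∘to
  where
  module I = Inverse (Code-fibre {F₀} {F} {E} (suc s) M)
  to : _
  to (inj₁ (l , k) , e) = inj₁ ((l , e) , k)
  to (inj₂ (i , k) , e) = inj₂ (i , I.to (k , e))
  from : _
  from (inj₁ ((l , e) , k)) = inj₁ (l , k) , e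
  from (inj₂ (i , k))       = inj₂ (i , proj₁ (I.from k)) , proj₂ (I.from k)
  to∘from : ∀ k → to (from k) ≡ k
  to∘from (inj₁ _)       = refl
  to∘from (inj₂ (i , k)) = cong (λ k → inj₂ (i , k)) (I.strictlyInverseˡ k)
  from∘to : ∀ k → from (to k) ≡ k
  from∘to (inj₁ _ , _) = refl
  from∘to (inj₂ (i , k) , e) = cong (λ (k , e) → inj₂ (i , k) , e) (I.strictlyInverseʳ (k , e))

Code↔Fin : ∀ {F₀ F q₀ q} → (∀ x → F₀ x ↔ Fin (q₀ x)) → (∀ x → F x ↔ Fin (q x)) →
           ∀ s M → Code F₀ F s M ↔ Fin (count q₀ q s (suc M))
Code↔Fin {F₀} {q₀ = q₀} F₀↔ F↔ s zero =
  subst (λ n → F₀ s ↔ Fin n) (sym (trans (+-identityʳ _) (*-identityʳ (q₀ s)))) (F₀↔ s)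
Code↔Fin F₀↔ F↔ s (suc M) =
  ↔-sym +↔⊎ ↔-∘ ((↔-sym *↔× ↔-∘ (F₀↔ s ×-↔ Code↔Fin F↔ F↔ 0 M))
            ⊎-↔ (↔-sym *↔× ↔-∘ (↔-id _ ×-↔ Code↔Fin F₀↔ F↔ (suc s) M)))

Fibre : ∀ {A : Set} → (A → ℕ) → ℕ → Set
Fibre f g = ∃ λ a → f a ≡ g

fibres : ∀ {A : Set} (f : A → ℕ) → A ↔ ∃ (Fibre f)
fibres f =
  mk↔ₛ′ (λ a → f a , a , refl) (λ (_ , a , _) → a) (λ { (_ , _ , refl) → refl }) (λ _ → refl)

fibrewise : ∀ {A B : Set} (f : A → ℕ) (h : B → ℕ) →
            (∀ g → Fibre f g ↔ Fibre h g) →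
            Σ[ φ ∈ A ↔ B ] (∀ a → h (Inverse.to φ a) ≡ f a)
fibrewise f h φ =
  (↔-sym (fibres h) ↔-∘ (congˡ (φ _) ↔-∘ fibres f)) , λ a → proj₂ (Inverse.to (φ (f a)) (a , refl))

choose : ∀ {A : Set} → Dec A → ℕ → ℕ
choose (yes _) b = b
choose (no  _) b = 0

choose-yes : ∀ {A : Set} (d : Dec A) {b} → A → choose d b ≡ b
choose-yes (yes _) _ = refl
choose-yes (no ¬a) a = contradiction a ¬a

choose-no : ∀ {A : Set} (d : Dec A) {b} → ¬ A → choose d b ≡ 0
choose-no (yes a) ¬a = contradiction a ¬a
choose-no (no _)  _  = refl

choose-cong : ∀ {A B : Set} (d : Dec A) (d′ : Dec B) {b} → (A → B) → (B → A) →
              choose d b ≡ choose d′ b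
choose-cong (yes a) d′ f _ = sym (choose-yes d′ (f a))
choose-cong (no ¬a) d′ _ g = sym (choose-no d′ (¬a ∘ g))

True×↔Fin : ∀ {A B : Set} {b} (d : Dec A) → B ↔ Fin b → (True d × B) ↔ Fin (choose d b)
True×↔Fin (yes _) B↔ = B↔ ↔-∘ mk↔ₛ′ proj₂ (tt ,_) (λ _ → refl) (λ _ → refl)
True×↔Fin (no _)  _  = mk↔ₛ′ (λ ()) (λ ()) (λ ()) (λ ())

≡↔Fin : ∀ m n → (m ≡ n) ↔ Fin (choose (m ≟ n) 1)
≡↔Fin m n = True×↔Fin (m ≟ n) (↔-sym 1↔⊤) ↔-∘
  (mk↔ₛ′ (_, tt) proj₁ (λ _ → refl) (λ _ → refl) ↔-∘ ↔-sym (True-↔ (m ≟ n) ≡-irrelevant))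

-- The bijection on permutations of `r * n` points

module Theorem (p-1 n-1 : ℕ) where

  private
    p r n M : ℕ
    p = suc p-1
    r = suc p
    n = suc n-1
    -- Chosen so that `suc M` and `r * n` agree by computation.
    M = n-1 + p * n

  singular? : ∀ l → Dec (r ∣ l)
  singular? l = r ∣? l

  regular? : ∀ l → Dec (r ∤ l)
  regular? l = ¬? (r ∣? l)

  ρ γ : ℕ → ℕ
  ρ x = choose (regular? (suc x)) 1
  γ x = choose (singular? (suc x)) p

  e : ℕ → ℕ → ℕ
  e g x = choose (x / r ≟ g) 1

  ∣-shift : ∀ {x} → r ∣ suc (r + x) → r ∣ suc x
  ∣-shift {x} d = ∣m+n∣m⇒∣n (subst (r ∣_) (sym (+-suc r x)) d) ∣-refl

  ∣-unshift : ∀ {x} → r ∣ suc x → r ∣ suc (r + x)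
  ∣-unshift {x} d = subst (r ∣_) (+-suc r x) (∣m∣n⇒∣m+n ∣-refl d)

  r∤small : ∀ {x} → x < p → r ∤ suc x
  r∤small x<p = >⇒∤ (s≤s x<p)

  /-shift : ∀ x → (r + x) / r ≡ suc (x / r)
  /-shift x = trans (+-distrib-/-∣ˡ x ∣-refl) (cong (_+ x / r) (n/n≡1 r))

  open Counting p {ρ} {γ}
    (λ x → choose-cong (regular? (suc (r + x))) (regular? (suc x)) (_∘ ∣-unshift) (_∘ ∣-shift))
    (λ x<p → choose-yes (regular? _) (r∤small x<p))
    (choose-no (regular? r) λ r∤r → r∤r ∣-refl)
    (λ x → choose-cong (singular? (suc (r + x))) (singular? (suc x)) ∣-shift ∣-unshift)
    (λ x<p → choose-no (singular? _) (r∤small x<p))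
    (choose-yes (singular? r) ∣-refl)

  open Graded e
    (λ {x} x<r → choose-yes (x / r ≟ 0) (m<n⇒m/n≡0 x<r))
    (λ x → choose-no ((r + x) / r ≟ 0) λ q → 1+n≢0 (trans (sym (/-shift x)) q))
    (λ g {x} x<r → choose-no (x / r ≟ suc g) λ q → 1+n≢0 (trans (sym q) (m<n⇒m/n≡0 x<r)))
    (λ g x → choose-cong ((r + x) / r ≟ suc g) (x / r ≟ g)
      (λ q → suc-injective (trans (sym (/-shift x)) q)) (λ q → trans (/-shift x) (cong suc q)))

  RegLabel CycLabel : ℕ → Set
  RegLabel = Label {C = ⊤} regular?
  CycLabel = Label {C = Fin p} singular?

  RegCode CycCode : Set
  RegCode = Code RegLabel RegLabel 0 M
  CycCode = Code CycLabel CycLabel 0 M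

  -- The gap is one less than the length, so exactly the lengths rk + 1, ..., rk + r have the value
  -- k.
  regBlock : RegCode → ℕ
  regBlock k = gap {RegLabel} {RegLabel} 0 M k / r

  cycBlock : CycCode → ℕ
  cycBlock k = gap {CycLabel} {CycLabel} 0 M k / r

  regLabel↔ : ∀ x → RegLabel x ↔ Fin (ρ x)
  regLabel↔ x = True×↔Fin (regular? (suc x)) (↔-sym 1↔⊤)

  cycLabel↔ : ∀ x → CycLabel x ↔ Fin (γ x)
  cycLabel↔ x = True×↔Fin (singular? (suc x)) (↔-id _)

  graded : ∀ {F : ℕ → Set} {q : ℕ → ℕ} → (∀ x → F x ↔ Fin (q x)) → ∀ g →
           Fibre (λ k → gap {F} {F} 0 M k / r) g ↔ Fin (count (q at g) q 0 (r * n))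
  graded {F} {q} F↔ g =
    Code↔Fin (λ x → ↔-sym *↔× ↔-∘ (F↔ x ×-↔ ≡↔Fin (x / r) g)) F↔ 0 M
      ↔-∘ Code-fibre {F} {F} {λ x → x / r ≡ g} 0 M

  counts : ∀ g → count (ρ at g) ρ 0 (r * n) ≡ count (γ at g) γ 0 (r * n)
  counts g = subst (λ N → count (ρ at g) ρ 0 N ≡ count (γ at g) γ 0 N)
    (*-comm n r) (graded-counts n g)

  block-preserving : Σ[ φ ∈ RegCode ↔ CycCode ] (∀ k → cycBlock (Inverse.to φ k) ≡ regBlock k)
  block-preserving = fibrewise regBlock cycBlock λ g →
    ↔-sym (graded cycLabel↔ g) ↔-∘
      subst (λ c → Fibre regBlock g ↔ Fin c) (counts g) (graded regLabel↔ g)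

  Reg↔Coloured : Inverse (Reg r (r * n)) (ColouredPermutation ⊤ (r ∤_) (r * n))
  Reg↔Coloured = record
    { to = λ σ → record
        { perm = RegularPermutation.perm σ ; lengths = RegularPermutation.regular σ
        ; colour = const tt ; colour-cong = λ _ → refl }
    ; from = λ σ → record { perm = Coloured.perm σ ; regular = Coloured.lengths σ }
    ; to-cong = λ p → p , λ _ → refl
    ; from-cong = proj₁
    ; inverse = (λ p → p , λ _ → refl) , proj₁
    }

  Coloured↔Cyc* : Inverse (ColouredPermutation (Fin p) (r ∣_) (r * n)) (Cyc* r (r * n))
  Coloured↔Cyc* = record
    { to = λ σ → record
        { perm = Coloured.perm σ ; singular = Coloured.lengths σ
        ; colour = Coloured.colour σ ; colour-cong = Coloured.colour-cong σ }
    ; from = λ σ → record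
        { perm = EnrichedCyclePermutation.perm σ ; lengths = EnrichedCyclePermutation.singular σ
        ; colour = EnrichedCyclePermutation.colour σ
        ; colour-cong = EnrichedCyclePermutation.colour-cong σ }
    ; to-cong = λ e → e
    ; from-cong = λ e → e
    ; inverse = (λ e → e) , λ e → e
    }

  encode : Inverse (Reg r (r * n)) (setoid RegCode)
  encode = Composition.inverse Reg↔Coloured (Symmetry.inverse (Code↔Coloured regular? M))

  Φ : Inverse (Reg r (r * n)) (Cyc* r (r * n))
  Φ = Composition.inverse encode
        (Composition.inverse (proj₁ block-preserving)
          (Composition.inverse (Code↔Coloured singular? M) Coloured↔Cyc*))

  block-of : ∀ {k i x} → 1 ≤ i → i ≤ p → suc x ≡ r * k + i → x / r ≡ k
  block-of {k} {suc i} {x} _ i≤p eq = begin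
    x / r             ≡⟨ cong (_/ r) (suc-injective (trans eq (+-suc (r * k) i))) ⟩
    (r * k + i) / r   ≡⟨ +-distrib-/-∣ˡ i (m∣m*n k) ⟩
    r * k / r + i / r ≡⟨ cong₂ _+_ (trans (cong (_/ r) (*-comm r k)) (m*n/n≡m k r))
                               (m<n⇒m/n≡0 (≤-trans i≤p (n≤1+n p))) ⟩
    k + 0             ≡⟨ +-identityʳ k ⟩
    k ∎

  -- The quotient of `suc x` by `r` is some `suc q`, hence `x = p + q * r` lies in block `q`.
  block-of-singular : ∀ {x} → r ∣ suc x → suc x ≡ r * (x / r) + r
  block-of-singular {x} (divides (suc q) eq) = begin
    suc x             ≡⟨ eq ⟩
    r + q * r         ≡⟨ +-comm r (q * r) ⟩
    q * r + r         ≡⟨ cong (_+ r) (*-comm q r) ⟩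
    r * q + r         ≡⟨ cong (λ q → r * q + r) (sym x/r≡q) ⟩
    r * (x / r) + r   ∎
    where
    x/r≡q : x / r ≡ q
    x/r≡q = begin
      x / r             ≡⟨ cong (_/ r) (suc-injective eq) ⟩
      (p + q * r) / r   ≡⟨ +-distrib-/-∣ʳ p (n∣m*n q) ⟩
      p / r + q * r / r ≡⟨ cong₂ _+_ (m<n⇒m/n≡0 {p} ≤-refl) (m*n/n≡m q r) ⟩
      q ∎

  cycleLength-Φ : (σ : RegularPermutation r (r * n)) (k i : ℕ) → 1 ≤ i → i ≤ p →
    cycleLength (RegularPermutation.perm σ) zero ≡ r * k + i →
    cycleLength (EnrichedCyclePermutation.perm (Inverse.to Φ σ)) zero ≡ r * k + r
  cycleLength-Φ σ k i 1≤i i≤p len = begin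
    cycleLength τ zero ≡⟨ τ-length ⟩
    suc (gap {CycLabel} {CycLabel} 0 M b)
      -- Only the last length of a block is divisible by `r`, so the block determines the length.
      ≡⟨ block-of-singular (subst (r ∣_) τ-length
           (EnrichedCyclePermutation.singular (Inverse.to Φ σ) zero)) ⟩
    r * cycBlock b + r
      ≡⟨ cong (λ k → r * k + r) (trans (proj₂ block-preserving a)
           (block-of {k} 1≤i i≤p (trans (sym σ-length) len))) ⟩
    r * k + r ∎
    where
    a : RegCode
    a = Inverse.to encode σ
    b : CycCode
    b = Inverse.to (proj₁ block-preserving) a
    τ = EnrichedCyclePermutation.perm (Inverse.to Φ σ)
    σ-length : cycleLength (RegularPermutation.perm σ) zero ≡ suc (gap {RegLabel} {RegLabel} 0 M a)
    σ-length = cycleLength-decode regular? M a {RegularPermutation.perm σ}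
      (Inverse.strictlyInverseʳ encode σ)
    τ-length : cycleLength τ zero ≡ suc (gap {CycLabel} {CycLabel} 0 M b)
    τ-length = cycleLength-decode singular? M b {τ} (λ _ → refl)

theorem2p1 : (r n : ℕ) (2≤r : 2 ≤ r) (1≤n : 1 ≤ n) →
  Σ[ Φ ∈ Bijection (Reg r (r * n)) (Cyc* r (r * n)) ]
    ((σ : RegularPermutation r (r * n)) (k i : ℕ) → 1 ≤ i → i ≤ r ∸ 1 →
      cycleLength (RegularPermutation.perm σ) (one 2≤r 1≤n) ≡ r * k + i →
      cycleLength (EnrichedCyclePermutation.perm (Bijection.to Φ σ)) (one 2≤r 1≤n) ≡ r * k + r)
-- With `r` and `n` matched as successors, `r * n` is a successor and `one` computes to `zero`.
theorem2p1 (suc (suc p-1)) (suc n-1) (s≤s (s≤s z≤n)) (s≤s z≤n) =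
  Inverse⇒Bijection Φ , cycleLength-Φ
  where open Theorem p-1 n-1
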